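{- Every finite member $\mathbf{A}$ of $\mathsf{CIdInRL}$ can be constructed by the gluing construction starting from all finite Boolean algebras; that is, $\mathbf{A}$ belongs to the smallest class of algebras that contains all finite Boolean algebras and is closed under isomorphic copies and under forming gluings $\mathbf{A}_1\oplus_\varphi\mathbf{A}_2$.
   Context: A commutative idempotent involutive residuated lattice is an algebra $\mathbf{A}=\langle A,\wedge,\vee,\cdot,\to,1,0\rangle$ such that $\langle A,\wedge,\vee\rangle$ is a lattice (with lattice order $\leq$), $\langle A,\cdot,1\rangle$ is a commutative monoid with $x\cdot x=x$ for all $x$, residuation holds ($x\cdot y\leq z \iff y\leq x\to z$), and, writing $-x := x\to 0$, one has $-{ - }x=x$ for all $x$. The class of these algebras is $\mathsf{CIdInRL}$. The monoidal order is $x\sqsubseteq y :\Leftrightarrow x\cdot y=x$. Put $0_x := x\wedge -x$ and $A^- := \{x\in A\mid x\leq 1\}$ (negative cone). A Boolean algebra (including the one-element one) is regarded as a member of $\mathsf{CIdInRL}$ with $\cdot=\wedge$, $1$ the top, $0$ the bottom, and $x\to y$ the Boolean implication. Gluing datum: $\mathbf{A},\mathbf{B}\in\mathsf{CIdInRL}$ with $A\cap B=\emptyset$ (operations and orders superscripted by $A$, $B$); an element $a\in A^-$ with $a\nleq 0^A$; an element $b\in B^-$; and a bijection $\varphi\colon\{x\in A\mid a\sqsubseteq^A x\}\to\{y\in B\mid y\sqsubseteq^B b\}$ such that $\varphi(x\cdot^A y)=\varphi(x)\cdot^B\varphi(y)$ and $\varphi(x\vee^A y)=\varphi(x)\vee^B\varphi(y)$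 for all $x,y$ in its domain, and $0_b=\varphi(a\vee^A 0^A)$, where $0_b = b\wedge^B -^B b$. (The domain of $\varphi$ is closed under $\cdot^A,\vee^A$ and contains $a\vee^A 0^A$.) The gluing $\mathbf{A}\oplus_\varphi\mathbf{B}$ (which is a member of $\mathsf{CIdInRL}$) has universe $A\cup B$, constants $0=0^B$, $1=1^B$, involution $-x=-^A x$ for $x\in A$ and $-x=-^B x$ for $x\in B$, and operations: $x\cdot y=x\cdot^A y$ if $x,y\in A$; $x\cdot y=x\cdot^B y$ if $x,y\in B$; $x\cdot y=y\cdot x=x\cdot^A\varphi^{ -1}(y\cdot^B b)$ if $x\in A$, $y\in B$. Further $x\vee y=x\vee^A y$ if $x,y\in A$; $x\vee y=x\vee^B y$ if $x,y\in B$; and for $x\in A$, $y\in B$: $x\vee y=y\vee x=\varphi(x\vee^A a)\vee^B y$ if $x\leq^A -^A a$, and $x\vee y=y\vee x=x\vee^A\varphi^{ -1}(y\cdot^B b)$ if $x\nleq^A -^A a$. Finally $x\to y := -(-y\cdot x)$ and $x\wedge y := -(-x\vee -y)$. -}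

module Defs where

open import Level using (Level; suc)
open import Algebra.Core using (Op₁; Op₂)
open import Algebra.Structures using (IsIdempotentCommutativeMonoid)
open import Algebra.Lattice.Structures using (IsLattice; IsBooleanAlgebra)
open import Algebra.Lattice.Bundles using (Lattice)
import Algebra.Lattice.Properties.Lattice as LatticeProperties
open import Data.Fin.Base using (Fin)
open import Data.Product.Base using (∃; _,_; proj₁)
open import Data.Sum.Base using (_⊎_; inj₁; inj₂)
open import Function.Bundles using (_↔_; _⇔_; Inverse; Equivalence)
open import Relation.Binary.Definitions using (DecidableEquality)
import Relation.Binary.Construct.NaturalOrder.Left as NaturalOrder
import Relation.Binary.Lattice.Bundles as Order
open import Relation.Binary.PropositionalEquality
  using (_≡_; refl; sym; trans; cong; cong₂; subst; module ≡-Reasoning)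
open import Relation.Nullary using (¬_; yes; no)

private
  variable
    ℓ : Level

Finite : Set ℓ → Set ℓ
Finite A = ∃ λ n → A ↔ Fin n

record RawAlgebra (ℓ : Level) : Set (suc ℓ) where
  infix  8 -_
  infixl 7 _·_
  infixr 7 _∧_
  infixr 6 _∨_
  infixr 5 _⇒_
  field
    Carrier : Set ℓ
    _∧_ _∨_ _·_ _⇒_ : Op₂ Carrier
    1# 0# : Carrier

  -_ : Op₁ Carrier
  - x = x ⇒ 0#

  -- x ≤ y unfolds to x ≡ x ∧ y, and x ⊑ y to x ≡ x · y.
  open NaturalOrder {A = Carrier} _≡_ _∧_ public using (_≤_)
  open NaturalOrder {A = Carrier} _≡_ _·_ public using () renaming (_≤_ to _⊑_)

  0[_] : Op₁ Carrier
  0[ x ] = x ∧ - x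

  ↑_ ↓_ : Carrier → Set ℓ
  ↑ a = ∃ λ x → a ⊑ x
  ↓ b = ∃ λ y → y ⊑ b

record IsCIdInRL (𝐀 : RawAlgebra ℓ) : Set ℓ where
  open RawAlgebra 𝐀
  field
    isLattice  : IsLattice _≡_ _∨_ _∧_
    isIdempotentCommutativeMonoid : IsIdempotentCommutativeMonoid _≡_ _·_ 1#
    residuated : ∀ x y z → (x · y ≤ z) ⇔ (y ≤ x ⇒ z)
    involutive : ∀ x → - (- x) ≡ x

  open IsIdempotentCommutativeMonoid isIdempotentCommutativeMonoid public
    using (identityˡ; identityʳ) renaming
    (assoc to ·-assoc; comm to ·-comm; idem to ·-idem)
  open IsLattice isLattice public using (∨-comm)

  private
    lattice : Lattice ℓ ℓ
    lattice = record { isLattice = isLattice }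

    module L = Order.Lattice (LatticeProperties.∨-∧-orderTheoreticLattice lattice)

    resid→ : ∀ {x y z} → x · y ≤ z → y ≤ x ⇒ z
    resid→ = Equivalence.to (residuated _ _ _)

    resid← : ∀ {x y z} → y ≤ x ⇒ z → x · y ≤ z
    resid← = Equivalence.from (residuated _ _ _)

    ·-monoʳ : ∀ x {y z} → y ≤ z → x · y ≤ x · z
    ·-monoʳ x y≤z = resid← (L.trans y≤z (resid→ L.refl))

    ·-distribˡ-∨ : ∀ x y z → x · (y ∨ z) ≡ x · y ∨ x · z
    ·-distribˡ-∨ x y z = L.antisym
      (resid← (L.∨-least (resid→ (L.x≤x∨y _ _)) (resid→ (L.y≤x∨y _ _))))
      (L.∨-least (·-monoʳ x (L.x≤x∨y y z)) (·-monoʳ x (L.y≤x∨y y z)))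

    -1≡0 : - 1# ≡ 0#
    -1≡0 = L.antisym
      (subst (_≤ 0#) (identityˡ _) (resid← L.refl))
      (resid→ (L.reflexive (identityˡ 0#)))

    0≤1 : 0# ≤ 1#
    0≤1 = subst (0# ≤_) (trans (cong -_ (sym -1≡0)) (involutive 1#))
      (resid→ (L.reflexive (·-idem 0#)))

  ↑-· : ∀ {a x y} → a ⊑ x → a ⊑ y → a ⊑ x · y
  ↑-· a⊑x a⊑y =
    trans a⊑y (trans (cong (_· _) a⊑x) (·-assoc _ _ _))

  ↑-∨ : ∀ {a x y} → a ⊑ x → a ⊑ y → a ⊑ x ∨ y
  ↑-∨ {a} {x} {y} a⊑x a⊑y = begin
    a              ≡⟨ LatticeProperties.∨-idem lattice a ⟨
    a ∨ a          ≡⟨ cong₂ _∨_ a⊑x a⊑y ⟩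
    a · x ∨ a · y  ≡⟨ ·-distribˡ-∨ a x y ⟨
    a · (x ∨ y)    ∎
    where open ≡-Reasoning

  ↑-∨-a : ∀ {a x} → a ≤ 1# → x ≤ - a → a ⊑ x ∨ a
  ↑-∨-a {a} {x} a≤1 x≤-a = L.antisym a≤ ≤a
    where
    ax≤a : a · x ≤ a
    ax≤a = subst (_≤ a)
      (trans (sym (·-assoc a a x)) (cong (_· x) (·-idem a)))
      (subst (a · (a · x) ≤_) (identityʳ a)
        (·-monoʳ a (L.trans (resid← x≤-a) 0≤1)))

    eq : a · (x ∨ a) ≡ a · x ∨ a
    eq = trans (·-distribˡ-∨ a x a) (cong (a · x ∨_) (·-idem a))

    a≤ : a ≤ a · (x ∨ a)
    a≤ = subst (a ≤_) (sym eq) (L.y≤x∨y _ _)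

    ≤a : a · (x ∨ a) ≤ a
    ≤a = subst (_≤ a) (sym eq) (L.∨-least ax≤a L.refl)

  ↑-a∨0 : ∀ {a} → a ≤ 1# → a ⊑ a ∨ 0#
  ↑-a∨0 {a} a≤1 = subst (a ⊑_) (∨-comm 0# a) (↑-∨-a a≤1
    (resid→ (subst (_≤ 0#) (·-comm 0# a)
      (subst (0# · a ≤_) (identityʳ 0#) (·-monoʳ 0# a≤1)))))

  ↓-· : ∀ b y → y · b ⊑ b
  ↓-· b y = sym (trans (·-assoc y b b) (cong (y ·_) (·-idem b)))

module _ {𝐀 𝐁 : RawAlgebra ℓ} (cA : IsCIdInRL 𝐀) (cB : IsCIdInRL 𝐁) where
  private
    module A = RawAlgebra 𝐀
    module B = RawAlgebra 𝐁
    module cA = IsCIdInRL cA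
    module cB = IsCIdInRL cB

  record GluingDatum : Set ℓ where
    field
      a    : A.Carrier
      a≤1  : a A.≤ A.1#
      a≰0  : ¬ (a A.≤ A.0#)
      b    : B.Carrier
      b≤1  : b B.≤ B.1#
      φ    : (A.↑ a) ↔ (B.↓ b)

    open Inverse φ using (to)

    field
      φ-·  : ∀ {x y} (p : a A.⊑ x) (q : a A.⊑ y) →
             proj₁ (to (x A.· y , cA.↑-· p q)) ≡ proj₁ (to (x , p)) B.· proj₁ (to (y , q))
      φ-∨  : ∀ {x y} (p : a A.⊑ x) (q : a A.⊑ y) →
             proj₁ (to (x A.∨ y , cA.↑-∨ p q)) ≡ proj₁ (to (x , p)) B.∨ proj₁ (to (y , q))
      0[b]≡φ[a∨0] : B.0[ b ] ≡ proj₁ (to (a A.∨ A.0# , cA.↑-a∨0 a≤1))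

  -- The disjoint union is the sum type. Decidable equality on A is needed only
  -- to branch on x ≤ - a in the mixed joins; every finite type has it.
  gluing : DecidableEquality A.Carrier → GluingDatum → RawAlgebra ℓ
  gluing _≟_ datum = record
    { Carrier = G
    ; _∧_     = λ x y → neg (join (neg x) (neg y))
    ; _∨_     = join
    ; _·_     = mul
    ; _⇒_     = λ x y → neg (mul (neg y) x)
    ; 1#      = inj₂ B.1#
    ; 0#      = inj₂ B.0#
    }
    where
    open GluingDatum datum
    open Inverse φ using (to; from)

    G : Set ℓ
    G = A.Carrier ⊎ B.Carrier

    neg : Op₁ G
    neg (inj₁ x) = inj₁ (A.- x)
    neg (inj₂ y) = inj₂ (B.- y)

    φ⁻¹[_·b] : B.Carrier → A.Carrier
    φ⁻¹[ y ·b] = proj₁ (from (y B.· b , cB.↓-· b y))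

    mixedMul : A.Carrier → B.Carrier → G
    mixedMul x y = inj₁ (x A.· φ⁻¹[ y ·b])

    mul : Op₂ G
    mul (inj₁ x) (inj₁ y) = inj₁ (x A.· y)
    mul (inj₁ x) (inj₂ y) = mixedMul x y
    mul (inj₂ y) (inj₁ x) = mixedMul x y
    mul (inj₂ x) (inj₂ y) = inj₂ (x B.· y)

    mixedJoin : A.Carrier → B.Carrier → G
    mixedJoin x y with x ≟ (x A.∧ A.- a)
    ... | yes x≤-a = inj₂ (proj₁ (to (x A.∨ a , cA.↑-∨-a a≤1 x≤-a)) B.∨ y)
    ... | no  _    = inj₁ (x A.∨ φ⁻¹[ y ·b])

    join : Op₂ G
    join (inj₁ x) (inj₁ y) = inj₁ (x A.∨ y)
    join (inj₁ x) (inj₂ y) = mixedJoin x y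
    join (inj₂ y) (inj₁ x) = mixedJoin x y
    join (inj₂ x) (inj₂ y) = inj₂ (x B.∨ y)

booleanAlgebra : {X : Set ℓ} {_∨_ _∧_ : Op₂ X} {~_ : Op₁ X} {⊤ ⊥ : X} →
                 IsBooleanAlgebra _≡_ _∨_ _∧_ ~_ ⊤ ⊥ → RawAlgebra ℓ
booleanAlgebra {X = X} {_∨_} {_∧_} {~_} {⊤} {⊥} _ = record
  { Carrier = X
  ; _∧_     = _∧_
  ; _∨_     = _∨_
  ; _·_     = _∧_
  ; _⇒_     = λ x y → (~ x) ∨ y
  ; 1#      = ⊤
  ; 0#      = ⊥
  }

record _≅_ (𝐀 𝐁 : RawAlgebra ℓ) : Set ℓ where
  private
    module A = RawAlgebra 𝐀
    module B = RawAlgebra 𝐁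
  field
    bijection : A.Carrier ↔ B.Carrier

  open Inverse bijection using (to)

  field
    ∧-homo : ∀ x y → to (x A.∧ y) ≡ to x B.∧ to y
    ∨-homo : ∀ x y → to (x A.∨ y) ≡ to x B.∨ to y
    ·-homo : ∀ x y → to (x A.· y) ≡ to x B.· to y
    ⇒-homo : ∀ x y → to (x A.⇒ y) ≡ (to x B.⇒ to y)
    1-homo : to A.1# ≡ B.1#
    0-homo : to A.0# ≡ B.0#

data Constructible {ℓ} : RawAlgebra ℓ → Set (suc ℓ) where
  boolean : {X : Set ℓ} {_∨_ _∧_ : Op₂ X} {~_ : Op₁ X} {⊤ ⊥ : X} →
            Finite X → (isBA : IsBooleanAlgebra _≡_ _∨_ _∧_ ~_ ⊤ ⊥) →
            Constructible (booleanAlgebra isBA)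
  iso     : ∀ {𝐀 𝐁} → 𝐀 ≅ 𝐁 → Constructible 𝐀 → Constructible 𝐁
  glue    : ∀ {𝐀 𝐁} (cA : IsCIdInRL 𝐀) (cB : IsCIdInRL 𝐁)
            (_≟_ : DecidableEquality (RawAlgebra.Carrier 𝐀)) (datum : GluingDatum cA cB) →
            Constructible 𝐀 → Constructible 𝐁 →
            Constructible (gluing cA cB _≟_ datum)

{-# OPTIONS --safe #-}

-- The elements 0[ x ] are exactly those below 0#, and x ↦ 0[ x ] is multiplicative.
-- If 0# is the only one, then 𝐀 is Boolean. Otherwise let p be a coatom among
-- them and q the product of all d with p ∨ d ≡ 0#. Then every x satisfies either
-- 0[ x ] ≤ p or q ≤ 0[ x ], that is, x ⊑ - p or q ⊑ x, so 𝐀 is the disjoint union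
-- of ↓ (- p) and ↑ q. Both are smaller members of CIdInRL, with constants - p, p
-- and 1#, 0#, and 𝐀 is their gluing: with a = q · - p, c = - (p ∨ a), b = q ∨ c,
-- the maps φ x = q ∨ x · c and ψ y = - p · y are mutually inverse between
-- the elements of ↓ (- p) above a and those of ↑ q below b, in the order ⊑.
module Submission where

open import Level using (Level)
open import Algebra.Bundles using (IdempotentCommutativeMonoid)
open import Algebra.Lattice.Bundles using (Lattice)
import Algebra.Lattice.Properties.Lattice as LatticeProperties
open import Algebra.Lattice.Structures using (IsLattice; IsDistributiveLattice; IsBooleanAlgebra)
open import Algebra.Lattice.Structures.Biased using (isDistributiveLatticeʳʲᵐ; isBooleanAlgebraʳ)
import Algebra.Solver.IdempotentCommutativeMonoid as MonoidSolver
open import Data.Empty using (⊥; ⊥-elim)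
open import Data.Fin.Base using (Fin; zero; suc)
open import Data.Fin.Permutation using (↔⇒≡)
open import Data.Fin.Properties using (inj⇒≟; +↔⊎; toℕ<n)
open import Data.List.Base using (List; []; _∷_; tabulate)
open import Data.List.Relation.Unary.All as All using (All; []; _∷_; all?)
open import Data.List.Relation.Unary.All.Properties using (tabulate⁻; ¬All⇒Any¬)
open import Data.List.Relation.Unary.Any using (satisfied)
open import Data.Nat.Base using (ℕ; zero; suc; _+_; _<_; z≤n)
open import Data.Nat.Induction using (<-wellFounded)
open import Data.Nat.Properties using (≤-<-trans; m<m+n; m<n+m)
open import Data.Product.Base using (∃; Σ; _×_; _,_; proj₁; proj₂)
open import Data.Sum.Base as Sum using (_⊎_; inj₁; inj₂; [_,_])
open import Data.Sum.Function.Propositional using (_⊎-↔_)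
open import Function.Base using (_∘_)
open import Function.Bundles using (_↔_; Inverse; Equivalence; mk↔ₛ′; mk⇔)
open import Function.Construct.Composition using (_↔-∘_)
open import Function.Construct.Identity using (↔-id)
open import Function.Construct.Symmetry using (↔-sym)
open import Function.Properties.Inverse using (↔⇒↣)
open import Induction.WellFounded using (Acc; acc)
open import Relation.Binary.Definitions using (DecidableEquality)
import Relation.Binary.Lattice.Bundles as Order
open import Relation.Binary.PropositionalEquality
  using (_≡_; _≢_; refl; sym; trans; cong; cong₂; subst; isEquivalence; module ≡-Reasoning)
open import Relation.Binary.PropositionalEquality.WithK using (≡-irrelevant)
import Relation.Binary.Reasoning.PartialOrder as PosetReasoning
open import Relation.Nullary using (¬_; Dec; yes; no; contradiction)
open import Relation.Nullary.Decidable using (map′)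
open import Relation.Unary using (Decidable; Irrelevant)
open import Defs

private
  variable
    ℓ : Level

-- Arithmetic of commutative idempotent involutive residuated lattices.

module Properties {𝐀 : RawAlgebra ℓ} (cA : IsCIdInRL 𝐀) where
  open RawAlgebra 𝐀 public
  open IsCIdInRL cA public

  private
    lattice : Lattice ℓ ℓ
    lattice = record { isLattice = isLattice }

    monoid : IdempotentCommutativeMonoid ℓ ℓ
    monoid = record { isIdempotentCommutativeMonoid = isIdempotentCommutativeMonoid }

    orderLattice : Order.Lattice ℓ ℓ ℓ
    orderLattice = LatticeProperties.∨-∧-orderTheoreticLattice lattice

  open MonoidSolver monoid public using (solve; _⊜_; _⊕_)
  open Order.Lattice orderLattice public
    using (x≤x∨y; y≤x∨y; ∨-least; x∧y≤x; x∧y≤y; ∧-greatest)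
    renaming (refl to ≤-refl; reflexive to ≤-reflexive; trans to ≤-trans; antisym to ≤-antisym)

  module ≤-Reasoning = PosetReasoning (Order.Lattice.poset orderLattice)

  -- Without abstract, comparing gluings unfolds these proofs and exhausts memory.
  abstract
    residual : ∀ {x y z} → x · y ≤ z → y ≤ x ⇒ z
    residual = Equivalence.to (residuated _ _ _)

    unresidual : ∀ {x y z} → y ≤ x ⇒ z → x · y ≤ z
    unresidual = Equivalence.from (residuated _ _ _)

    ·-monoʳ : ∀ x {y z} → y ≤ z → x · y ≤ x · z
    ·-monoʳ x y≤z = unresidual (≤-trans y≤z (residual ≤-refl))

    ·-mono : ∀ {u x v y} → u ≤ x → v ≤ y → u · v ≤ x · y
    ·-mono {u} {x} {v} {y} u≤x v≤y = begin
      u · v  ≤⟨ ·-monoʳ u v≤y ⟩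
      u · y  ≡⟨ ·-comm u y ⟩
      y · u  ≤⟨ ·-monoʳ y u≤x ⟩
      y · x  ≡⟨ ·-comm y x ⟩
      x · y  ∎
      where open ≤-Reasoning

    ·-distribˡ-∨ : ∀ x y z → x · (y ∨ z) ≡ x · y ∨ x · z
    ·-distribˡ-∨ x y z = ≤-antisym
      (unresidual (∨-least (residual (x≤x∨y _ _)) (residual (y≤x∨y _ _))))
      (∨-least (·-monoʳ x (x≤x∨y y z)) (·-monoʳ x (y≤x∨y y z)))

    ·-distribʳ-∨ : ∀ x y z → (y ∨ z) · x ≡ y · x ∨ z · x
    ·-distribʳ-∨ x y z = trans (·-comm _ x)
      (trans (·-distribˡ-∨ x y z) (cong₂ _∨_ (·-comm x y) (·-comm x z)))

    x·-x≤0 : ∀ x → x · - x ≤ 0#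
    x·-x≤0 x = unresidual ≤-refl

    -x·x≤0 : ∀ x → - x · x ≤ 0#
    -x·x≤0 x = subst (_≤ 0#) (·-comm x (- x)) (x·-x≤0 x)

    ≤⇒·-≤0 : ∀ {x y} → x ≤ y → x · - y ≤ 0#
    ≤⇒·-≤0 {y = y} x≤y = ≤-trans (·-mono x≤y ≤-refl) (x·-x≤0 y)

    ·-≤0⇒≤ : ∀ {x y} → - y · x ≤ 0# → x ≤ y
    ·-≤0⇒≤ {x} p = subst (x ≤_) (involutive _) (residual p)

    -‿anti : ∀ {x y} → x ≤ y → - y ≤ - x
    -‿anti x≤y = residual (≤⇒·-≤0 x≤y)

    -‿swapʳ : ∀ {x y} → x ≤ - y → y ≤ - x
    -‿swapʳ {x} {y} p = subst (_≤ - x) (involutive y) (-‿anti p)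

    -1≡0 : - 1# ≡ 0#
    -1≡0 = ≤-antisym
      (subst (_≤ 0#) (identityˡ _) (x·-x≤0 1#))
      (residual (≤-reflexive (identityˡ 0#)))

    -0≡1 : - 0# ≡ 1#
    -0≡1 = trans (cong -_ (sym -1≡0)) (involutive 1#)

    0≤1 : 0# ≤ 1#
    0≤1 = subst (0# ≤_) -0≡1 (residual (≤-reflexive (·-idem 0#)))

    ≤0⇒≤1 : ∀ {x} → x ≤ 0# → x ≤ 1#
    ≤0⇒≤1 x≤0 = ≤-trans x≤0 0≤1

    ≤0⇒1≤- : ∀ {x} → x ≤ 0# → 1# ≤ - x
    ≤0⇒1≤- {x} x≤0 = subst (_≤ - x) -0≡1 (-‿anti x≤0)

    -- Residuation gives both inequalities. Together with `∧-def` this reduces closure and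
    -- homomorphism claims to `·`, `∨` and `-`.
    ⇒-def : ∀ x y → x ⇒ y ≡ - (- y · x)
    ⇒-def x y = ≤-antisym
      (residual (begin
        - y · x · (x ⇒ y)    ≡⟨ ·-assoc _ _ _ ⟩
        - y · (x · (x ⇒ y))  ≤⟨ ·-monoʳ (- y) (unresidual ≤-refl) ⟩
        - y · y              ≤⟨ -x·x≤0 y ⟩
        0#                   ∎))
      (residual (·-≤0⇒≤ (begin
        - y · (x · - (- y · x))  ≡⟨ ·-assoc _ _ _ ⟨
        - y · x · - (- y · x)    ≤⟨ x·-x≤0 _ ⟩
        0#                       ∎)))
      where open ≤-Reasoning

    -‿∨ : ∀ x y → - (x ∨ y) ≡ - x ∧ - y
    -‿∨ x y = ≤-antisym
      (∧-greatest (-‿anti (x≤x∨y x y)) (-‿anti (y≤x∨y x y)))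
      (-‿swapʳ (∨-least (-‿swapʳ (x∧y≤x _ _)) (-‿swapʳ (x∧y≤y _ _))))

    ∧-def : ∀ x y → x ∧ y ≡ - (- x ∨ - y)
    ∧-def x y = sym (trans (-‿∨ (- x) (- y)) (cong₂ _∧_ (involutive x) (involutive y)))

    -x∨x≡-0[x] : ∀ x → - x ∨ x ≡ - 0[ x ]
    -x∨x≡-0[x] x = begin
      - x ∨ x            ≡⟨ cong (- x ∨_) (involutive x) ⟨
      - x ∨ - - x        ≡⟨ involutive _ ⟨
      - - (- x ∨ - - x)  ≡⟨ cong -_ (∧-def x (- x)) ⟨
      - 0[ x ]           ∎
      where open ≡-Reasoning

    x·y⊑y : ∀ x y → x · y ⊑ y
    x·y⊑y x y = trans (cong (x ·_) (sym (·-idem y))) (sym (·-assoc x y y))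

    ⊑-·ˡ : ∀ {x y z} → x ⊑ z → y · x ⊑ z
    ⊑-·ˡ {x} {y} {z} x⊑z = trans (cong (y ·_) x⊑z) (sym (·-assoc y x z))

    ⊑-∨ : ∀ {x y z} → x ⊑ z → y ⊑ z → x ∨ y ⊑ z
    ⊑-∨ {x} {y} {z} x⊑z y⊑z = trans (cong₂ _∨_ x⊑z y⊑z) (sym (·-distribʳ-∨ z x y))

    x≤y≤1⇒⊑ : ∀ {x y} → x ≤ y → y ≤ 1# → x ⊑ y
    x≤y≤1⇒⊑ {x} {y} x≤y y≤1 = ≤-antisym
      (subst (_≤ x · y) (·-idem x) (·-monoʳ x x≤y))
      (subst (x · y ≤_) (identityʳ x) (·-monoʳ x y≤1))

    ·≤ˡ : ∀ {x y} → y ≤ 1# → x · y ≤ x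
    ·≤ˡ {x} {y} y≤1 = subst (x · y ≤_) (identityʳ x) (·-monoʳ x y≤1)

    ·≤ʳ : ∀ {x y} → x ≤ 1# → x · y ≤ y
    ·≤ʳ {x} {y} x≤1 = subst (_≤ y) (·-comm y x) (·≤ˡ x≤1)

    ≤-·ˡ : ∀ {x y} → 1# ≤ y → x ≤ x · y
    ≤-·ˡ {x} {y} 1≤y = subst (_≤ x · y) (identityʳ x) (·-monoʳ x 1≤y)

    ≤1⇒·≡∧ : ∀ {x y} → x ≤ 1# → y ≤ 1# → x · y ≡ x ∧ y
    ≤1⇒·≡∧ {x} {y} x≤1 y≤1 = ≤-antisym
      (∧-greatest (·≤ˡ y≤1) (·≤ʳ x≤1))
      (subst (_≤ x · y) (·-idem (x ∧ y)) (·-mono (x∧y≤x x y) (x∧y≤y x y)))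

    -- The meet equals its own square, which is at most `x · - x`. Conversely `x · - x` absorbs a
    -- further factor `- x` or `x`, so residuation puts it below `x` and below `- x`.
    0[x]≡x·-x : ∀ x → 0[ x ] ≡ x · - x
    0[x]≡x·-x x = ≤-antisym
      (subst (_≤ x · - x) (·-idem _) (·-mono (x∧y≤x _ _) (x∧y≤y _ _)))
      (∧-greatest
        (·-≤0⇒≤ (subst (_≤ 0#) (solve 2 (λ y z → y ⊕ z ⊜ z ⊕ (y ⊕ z)) refl x (- x)) (x·-x≤0 x)))
        (residual (subst (_≤ 0#) (solve 2 (λ y z → y ⊕ z ⊜ y ⊕ (y ⊕ z)) refl x (- x)) (x·-x≤0 x))))

    0[x]≤0 : ∀ x → 0[ x ] ≤ 0#
    0[x]≤0 x = subst (_≤ 0#) (sym (0[x]≡x·-x x)) (x·-x≤0 x)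

    0[-x]≡0[x] : ∀ x → 0[ - x ] ≡ 0[ x ]
    0[-x]≡0[x] x = ≤-antisym
      (∧-greatest (subst (0[ - x ] ≤_) (involutive x) (x∧y≤y _ _)) (x∧y≤x _ _))
      (∧-greatest (x∧y≤y _ _) (subst (0[ x ] ≤_) (sym (involutive x)) (x∧y≤x _ _)))

    x≤0⇒0[x]≡x : ∀ {x} → x ≤ 0# → 0[ x ] ≡ x
    x≤0⇒0[x]≡x x≤0 = ≤-antisym (x∧y≤x _ _)
      (∧-greatest ≤-refl (≤-trans (≤0⇒≤1 x≤0) (≤0⇒1≤- x≤0)))

    -- Both sides are rewritten as products. Idempotence duplicates `x`, `y` and `- (x · y)`, and
    -- `y · - (x · y) ≤ - x` with its mirror image gives one direction. The other follows from
    -- `- x · - y ≤ - (x · y)`, which rests on `0# · 0# ≡ 0#`.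
    0[xy]≡0[x]·0[y] : ∀ x y → 0[ x · y ] ≡ 0[ x ] · 0[ y ]
    0[xy]≡0[x]·0[y] x y = begin
      0[ x · y ]             ≡⟨ 0[x]≡x·-x (x · y) ⟩
      x · y · - (x · y)      ≡⟨ ≤-antisym ≤xy ≥xy ⟩
      x · - x · (y · - y)    ≡⟨ cong₂ _·_ (0[x]≡x·-x x) (0[x]≡x·-x y) ⟨
      0[ x ] · 0[ y ]        ∎
      where
      open ≡-Reasoning

      y·-xy≤-x : ∀ x y → y · - (x · y) ≤ - x
      y·-xy≤-x x y = residual (subst (_≤ 0#) (·-assoc _ _ _) (x·-x≤0 (x · y)))

      ≤xy : x · y · - (x · y) ≤ x · - x · (y · - y)
      ≤xy = subst (_≤ x · - x · (y · - y))
        (solve 3 (λ x y z → (x ⊕ (y ⊕ z)) ⊕ (y ⊕ (x ⊕ z)) ⊜ (x ⊕ y) ⊕ z) refl x y (- (x · y)))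
        (·-mono (·-monoʳ x (y·-xy≤-x x y))
                (·-monoʳ y (subst (λ z → x · - z ≤ - y) (·-comm y x) (y·-xy≤-x y x))))

      -x·-y≤-xy : - x · - y ≤ - (x · y)
      -x·-y≤-xy = residual (subst (_≤ 0#)
        (solve 4 (λ x y u v → (x ⊕ u) ⊕ (y ⊕ v) ⊜ (x ⊕ y) ⊕ (u ⊕ v)) refl x y (- x) (- y))
        (subst (x · - x · (y · - y) ≤_) (·-idem 0#) (·-mono (x·-x≤0 x) (x·-x≤0 y))))

      ≥xy : x · - x · (y · - y) ≤ x · y · - (x · y)
      ≥xy = subst (_≤ x · y · - (x · y))
        (solve 4 (λ x y u v → (x ⊕ y) ⊕ (u ⊕ v) ⊜ (x ⊕ u) ⊕ (y ⊕ v)) refl x y (- x) (- y))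
        (·-monoʳ (x · y) -x·-y≤-xy)

    x·0[x]≡0[x] : ∀ x → x · 0[ x ] ≡ 0[ x ]
    x·0[x]≡0[x] x = subst (λ z → x · z ≡ z) (sym (0[x]≡x·-x x))
      (solve 2 (λ x y → x ⊕ (x ⊕ y) ⊜ x ⊕ y) refl x (- x))

    -- By `⇒-def`, `- 0[ x ]` is `x ⇒ x`, a local unit for `x`: it lies above `1#`, and
    -- `- x · (x · - 0[ x ])` is `0[ x ] · - 0[ x ]`, hence below `0#`.
    x⊑-0[x] : ∀ x → x ⊑ - 0[ x ]
    x⊑-0[x] x = ≤-antisym (≤-·ˡ (≤0⇒1≤- (0[x]≤0 x)))
      (·-≤0⇒≤ (subst (_≤ 0#)
        (solve 3 (λ x y z → (x ⊕ y) ⊕ z ⊜ y ⊕ (x ⊕ z)) refl x (- x) (- 0[ x ]))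
        (subst (λ z → z · - 0[ x ] ≤ 0#) (0[x]≡x·-x x) (x·-x≤0 0[ x ]))))

    -- Since `1# ≤ - p ≤ - 0[ x ]`, the product `x · - p` is squeezed between `x` and
    -- `x · - 0[ x ]`, which is `x`.
    0[x]≤p⇒⊑-p : ∀ {p x} → p ≤ 0# → 0[ x ] ≤ p → x ⊑ - p
    0[x]≤p⇒⊑-p {p} {x} p≤0 0[x]≤p = ≤-antisym (≤-·ˡ (≤0⇒1≤- p≤0))
      (subst (x · - p ≤_) (sym (x⊑-0[x] x)) (·-monoʳ x (-‿anti 0[x]≤p)))

    -- Applying the multiplicative map `0[_]` to `x ≡ x · - p` leaves a factor `p` on the right.
    ⊑-p⇒0[x]≤p : ∀ {p x} → p ≤ 0# → x ⊑ - p → 0[ x ] ≤ p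
    ⊑-p⇒0[x]≤p {p} {x} p≤0 x⊑-p = begin
      0[ x ]            ≡⟨ cong 0[_] x⊑-p ⟩
      0[ x · - p ]      ≡⟨ 0[xy]≡0[x]·0[y] x (- p) ⟩
      0[ x ] · 0[ - p ] ≡⟨ cong (0[ x ] ·_) (trans (0[-x]≡0[x] p) (x≤0⇒0[x]≡x p≤0)) ⟩
      0[ x ] · p        ≤⟨ ·≤ʳ (≤0⇒≤1 (0[x]≤0 x)) ⟩
      p                 ∎
      where open ≤-Reasoning

    -- Below `1#` the lattice order implies `⊑`, so `q` absorbs `0[ x ]`, which in turn absorbs `x`.
    q≤0[x]⇒q⊑ : ∀ {q x} → q ≤ 0[ x ] → q ⊑ x
    q≤0[x]⇒q⊑ {q} {x} q≤0[x] = begin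
      q                ≡⟨ q⊑0[x] ⟩
      q · 0[ x ]       ≡⟨ cong (q ·_) (x·0[x]≡0[x] x) ⟨
      q · (x · 0[ x ]) ≡⟨ solve 3 (λ q x z → q ⊕ (x ⊕ z) ⊜ (q ⊕ z) ⊕ x) refl q x 0[ x ] ⟩
      (q · 0[ x ]) · x ≡⟨ cong (_· x) q⊑0[x] ⟨
      q · x            ∎
      where
      open ≡-Reasoning
      q⊑0[x] : q ⊑ 0[ x ]
      q⊑0[x] = x≤y≤1⇒⊑ q≤0[x] (≤0⇒≤1 (0[x]≤0 x))

    q⊑⇒q≤0[x] : ∀ {q x} → q ≤ 0# → q ⊑ x → q ≤ 0[ x ]
    q⊑⇒q≤0[x] {q} {x} q≤0 q⊑x = begin
      q                ≡⟨ x≤0⇒0[x]≡x q≤0 ⟨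
      0[ q ]           ≡⟨ cong 0[_] q⊑x ⟩
      0[ q · x ]       ≡⟨ 0[xy]≡0[x]·0[y] q x ⟩
      0[ q ] · 0[ x ]  ≤⟨ ·≤ʳ (≤0⇒≤1 (0[x]≤0 q)) ⟩
      0[ x ]           ∎
      where open ≤-Reasoning

-- Counting decidable subsets of finite sets.

proj₁-injective : ∀ {ℓ₁ ℓ₂} {A : Set ℓ₁} {P : A → Set ℓ₂} → Irrelevant P →
                  {u v : Σ A P} → proj₁ u ≡ proj₁ v → u ≡ v
proj₁-injective irr {x , p} {.x , q} refl = cong (x ,_) (irr p q)

finite-Fin-subset : ∀ n {P : Fin n → Set ℓ} → Decidable P → Irrelevant P → Finite (Σ (Fin n) P)
finite-Fin-subset zero P? irr = 0 , mk↔ₛ′ (λ ()) (λ ()) (λ ()) (λ ())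
finite-Fin-subset (suc n) {P} P? irr with finite-Fin-subset n (P? ∘ suc) irr
... | m , e = extend (P? zero)
  where
  open Inverse e

  shift : Σ (Fin n) (P ∘ suc) → Σ (Fin (suc n)) P
  shift (i , q) = suc i , q

  extend : Dec (P zero) → Finite (Σ (Fin (suc n)) P)
  extend (yes p) = suc m , mk↔ₛ′
    (λ { (zero , _) → zero ; (suc i , q) → suc (to (i , q)) })
    (λ { zero → zero , p ; (suc j) → shift (from j) })
    (λ { zero → refl ; (suc j) → cong suc (strictlyInverseˡ j) })
    (λ { (zero , q) → cong (zero ,_) (irr p q) ; (suc i , q) → cong shift (strictlyInverseʳ (i , q)) })
  extend (no ¬p) = m , mk↔ₛ′
    (λ { (zero , q) → contradiction q ¬p ; (suc i , q) → to (i , q) })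
    (λ j → shift (from j))
    strictlyInverseˡ
    (λ { (zero , q) → contradiction q ¬p ; (suc i , q) → cong shift (strictlyInverseʳ (i , q)) })

finite-Σ : {A : Set ℓ} {P : A → Set ℓ} → Finite A → Decidable P → Irrelevant P → Finite (Σ A P)
finite-Σ {A = A} {P} (n , e) P? irr with finite-Fin-subset n (P? ∘ Inverse.from e) irr
... | m , f = m , f ↔-∘ mk↔ₛ′
    (λ (x , Px) → to x , subst P (sym (strictlyInverseʳ x)) Px)
    (λ (i , q) → from i , q)
    (λ (i , _) → proj₁-injective irr (strictlyInverseˡ i))
    (λ (x , _) → proj₁-injective irr (strictlyInverseʳ x))
  where open Inverse e

-- The sizes of the two pieces are never computed; a bijection of `Fin (m + n)` with `Fin k` already
-- fixes their sum.
⊎-size : {A B : Set ℓ} {m n k : ℕ} → A ↔ Fin m → B ↔ Fin n → (A ⊎ B) ↔ Fin k → m + n ≡ k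
⊎-size e f g = ↔⇒≡ (g ↔-∘ (↔-sym (e ⊎-↔ f) ↔-∘ +↔⊎))

inhabited⇒0<size : {A : Set ℓ} {n : ℕ} → A ↔ Fin n → A → 0 < n
inhabited⇒0<size e x = ≤-<-trans z≤n (toℕ<n (Inverse.to e x))

-- Computation rules for the operations of a gluing.

module Gluing {𝐀 𝐁 : RawAlgebra ℓ} (cA : IsCIdInRL 𝐀) (cB : IsCIdInRL 𝐁)
  (_≟_ : DecidableEquality (RawAlgebra.Carrier 𝐀)) (datum : GluingDatum cA cB)
  where

  private
    module A = RawAlgebra 𝐀
    module B = RawAlgebra 𝐁
    module cA = IsCIdInRL cA
    module cB = IsCIdInRL cB
    module G = RawAlgebra (gluing cA cB _≟_ datum)
  open GluingDatum datum
  open Inverse φ using (to; from)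

  -- The join branches on a decision that carries its own proof of `x ≤ - a`; irrelevance of
  -- equality proofs exchanges it for the given one.
  mixedJoin-≤ : ∀ x y (x≤-a : x A.≤ A.- a) →
    inj₁ x G.∨ inj₂ y ≡ inj₂ (proj₁ (to (x A.∨ a , cA.↑-∨-a a≤1 x≤-a)) B.∨ y)
  mixedJoin-≤ x y x≤-a with x ≟ (x A.∧ A.- a)
  ... | yes p    = cong (λ p → inj₂ (proj₁ (to (x A.∨ a , cA.↑-∨-a a≤1 p)) B.∨ y)) (≡-irrelevant p x≤-a)
  ... | no  x≰-a = contradiction x≤-a x≰-a

  mixedJoin-≰ : ∀ x y → ¬ (x A.≤ A.- a) →
    inj₁ x G.∨ inj₂ y ≡ inj₁ (x A.∨ proj₁ (from (y B.· b , cB.↓-· b y)))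
  mixedJoin-≰ x y x≰-a with x ≟ (x A.∧ A.- a)
  ... | yes x≤-a = contradiction x≤-a x≰-a
  ... | no  _    = refl

  -- The involution used by gluing, which is local to its definition.
  neg : G.Carrier → G.Carrier
  neg (inj₁ x) = inj₁ (A.- x)
  neg (inj₂ y) = inj₂ (B.- y)

  ⇒-as-neg : ∀ u v → u G.⇒ v ≡ neg (neg v G.· u)
  ⇒-as-neg (inj₁ _) (inj₁ _) = refl
  ⇒-as-neg (inj₁ _) (inj₂ _) = refl
  ⇒-as-neg (inj₂ _) (inj₁ _) = refl
  ⇒-as-neg (inj₂ _) (inj₂ _) = refl

  ∧-as-neg : ∀ u v → u G.∧ v ≡ neg (neg u G.∨ neg v)
  ∧-as-neg (inj₁ _) (inj₁ _) = refl
  -- Both involutions compute only on an explicit injection, so the undecided mixed join is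
  -- abstracted and split.
  ∧-as-neg (inj₁ x) (inj₂ y) with inj₁ (A.- x) G.∨ inj₂ (B.- y)
  ... | inj₁ _ = refl
  ... | inj₂ _ = refl
  ∧-as-neg (inj₂ y) (inj₁ x) with inj₂ (B.- y) G.∨ inj₁ (A.- x)
  ... | inj₁ _ = refl
  ... | inj₂ _ = refl
  ∧-as-neg (inj₂ _) (inj₂ _) = refl

-- Pieces of an algebra as algebras with their own constants.

module _ {𝐀 : RawAlgebra ℓ} (cA : IsCIdInRL 𝐀) where
  open Properties cA

  -- A subset of an algebra with its own constants ι and ζ is again a member of
  -- CIdInRL as soon as ι is neutral on it and ζ gives rise to the same involution.
  module Restriction (P : Carrier → Set ℓ) (P-irrelevant : Irrelevant P)
    (·-closed : ∀ {x y} → P x → P y → P (x · y))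
    (∨-closed : ∀ {x y} → P x → P y → P (x ∨ y))
    (-‿closed : ∀ {x} → P x → P (- x))
    {ι ζ : Carrier} (Pι : P ι) (Pζ : P ζ)
    (ι-identity : ∀ {x} → P x → ι · x ≡ x)
    (ζ-negation : ∀ {x} → P x → x ⇒ ζ ≡ - x)
    where

    ∧-closed : ∀ {x y} → P x → P y → P (x ∧ y)
    ∧-closed {x} {y} Px Py = subst P (sym (∧-def x y))
      (-‿closed (∨-closed (-‿closed Px) (-‿closed Py)))

    ⇒-closed : ∀ {x y} → P x → P y → P (x ⇒ y)
    ⇒-closed {x} {y} Px Py = subst P (sym (⇒-def x y))
      (-‿closed (·-closed (-‿closed Py) Px))

    restriction : RawAlgebra ℓ
    restriction = record
      { Carrier = Σ Carrier P
      ; _∧_     = λ (x , Px) (y , Py) → x ∧ y , ∧-closed Px Py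
      ; _∨_     = λ (x , Px) (y , Py) → x ∨ y , ∨-closed Px Py
      ; _·_     = λ (x , Px) (y , Py) → x · y , ·-closed Px Py
      ; _⇒_     = λ (x , Px) (y , Py) → x ⇒ y , ⇒-closed Px Py
      ; 1#      = ι , Pι
      ; 0#      = ζ , Pζ
      }

    ↑≡ : {u v : Σ Carrier P} → proj₁ u ≡ proj₁ v → u ≡ v
    ↑≡ = proj₁-injective P-irrelevant

    restriction-isCIdInRL : IsCIdInRL restriction
    restriction-isCIdInRL = record
      { isLattice = record
        { isEquivalence = isEquivalence
        ; ∨-comm     = λ _ _ → ↑≡ (∨-comm _ _)
        ; ∨-assoc    = λ _ _ _ → ↑≡ (∨-assoc _ _ _)
        ; ∨-cong     = λ { refl refl → refl }
        ; ∧-comm     = λ _ _ → ↑≡ (∧-comm _ _)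
        ; ∧-assoc    = λ _ _ _ → ↑≡ (∧-assoc _ _ _)
        ; ∧-cong     = λ { refl refl → refl }
        ; absorptive = (λ _ _ → ↑≡ (proj₁ absorptive _ _)) , (λ _ _ → ↑≡ (proj₂ absorptive _ _))
        }
      ; isIdempotentCommutativeMonoid = record
        { isCommutativeMonoid = record
          { isMonoid = record
            { isSemigroup = record
              { isMagma = record { isEquivalence = isEquivalence ; ∙-cong = λ { refl refl → refl } }
              ; assoc   = λ _ _ _ → ↑≡ (·-assoc _ _ _)
              }
            ; identity = (λ (_ , Px) → ↑≡ (ι-identity Px))
                       , (λ (_ , Px) → ↑≡ (trans (·-comm _ _) (ι-identity Px)))
            }
          ; comm = λ _ _ → ↑≡ (·-comm _ _)
          }
        ; idem = λ _ → ↑≡ (·-idem _)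
        }
      ; residuated = λ _ _ _ → mk⇔
          (λ xy≤z → ↑≡ (residual (cong proj₁ xy≤z)))
          (λ y≤x⇒z → ↑≡ (unresidual (cong proj₁ y≤x⇒z)))
      ; involutive = λ (_ , Px) → ↑≡
          (trans (cong (_⇒ ζ) (ζ-negation Px)) (trans (ζ-negation (-‿closed Px)) (involutive _)))
      }
      where open IsLattice isLattice using (∨-assoc; ∧-comm; ∧-assoc; absorptive)

  module Lower {p : Carrier} (p≤0 : p ≤ 0#) where

    ⊑-p-identity : ∀ {x} → x ⊑ - p → - p · x ≡ x
    ⊑-p-identity {x} x⊑-p = trans (·-comm (- p) x) (sym x⊑-p)

    ⊑-p-negation : ∀ {x} → x ⊑ - p → x ⇒ p ≡ - x
    ⊑-p-negation {x} x⊑-p = trans (⇒-def x p) (cong -_ (⊑-p-identity x⊑-p))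

    -- Membership in the piece depends only on `0[ x ]`, which negation leaves fixed.
    -‿⊑-p : ∀ {x} → x ⊑ - p → - x ⊑ - p
    -‿⊑-p {x} x⊑-p = 0[x]≤p⇒⊑-p p≤0
      (subst (_≤ p) (sym (0[-x]≡0[x] x)) (⊑-p⇒0[x]≤p p≤0 x⊑-p))

    p⊑-p : p ⊑ - p
    p⊑-p = 0[x]≤p⇒⊑-p p≤0 (x∧y≤x p (- p))

    open Restriction (_⊑ - p) ≡-irrelevant
      (λ _ → ⊑-·ˡ) ⊑-∨ -‿⊑-p
      {ι = - p} {ζ = p} (sym (·-idem (- p))) p⊑-p ⊑-p-identity ⊑-p-negation
      public renaming (restriction to lower; restriction-isCIdInRL to lower-isCIdInRL; ↑≡ to lower-≡)

  module Upper {q : Carrier} (q≤0 : q ≤ 0#) where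

    q⊑-‿ : ∀ {x} → q ⊑ x → q ⊑ - x
    q⊑-‿ {x} q⊑x = q≤0[x]⇒q⊑
      (subst (q ≤_) (sym (0[-x]≡0[x] x)) (q⊑⇒q≤0[x] q≤0 q⊑x))

    q⊑0 : q ⊑ 0#
    q⊑0 = x≤y≤1⇒⊑ q≤0 0≤1

    open Restriction (q ⊑_) ≡-irrelevant ↑-· ↑-∨ q⊑-‿
      {ι = 1#} {ζ = 0#} (sym (identityʳ q)) q⊑0 (λ _ → identityˡ _) (λ _ → refl)
      public renaming (restriction to upper; restriction-isCIdInRL to upper-isCIdInRL; ↑≡ to upper-≡)

  -- Recovering an algebra as the gluing of its two pieces.

  module Decomposition (_≟_ : DecidableEquality Carrier) {p q : Carrier} (p≤0 : p ≤ 0#) (q≤0 : q ≤ 0#)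
    (p≢0 : p ≢ 0#) (p∨q≡0 : p ∨ q ≡ 0#)
    (split : ∀ x → 0[ x ] ≤ p ⊎ q ≤ 0[ x ])
    where

    open Lower p≤0 public
    open Upper q≤0 public using (upper; upper-isCIdInRL; upper-≡)

    q≰p : ¬ (q ≤ p)
    q≰p q≤p = p≢0 (trans (sym (≤-antisym (∨-least ≤-refl q≤p) (x≤x∨y p q))) p∨q≡0)

    -- A common element would give `q ≤ 0[ x ] ≤ p`, making `p ∨ q` equal to `p` and so `p` equal to
    -- `0#`.
    disjoint : ∀ {x} → x ⊑ - p → q ⊑ x → ⊥
    disjoint x⊑-p q⊑x = q≰p (≤-trans (q⊑⇒q≤0[x] q≤0 q⊑x) (⊑-p⇒0[x]≤p p≤0 x⊑-p))

    q⊑x⇒q≤x : ∀ {x} → q ⊑ x → q ≤ x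
    q⊑x⇒q≤x q⊑x = ≤-trans (q⊑⇒q≤0[x] q≤0 q⊑x) (x∧y≤x _ _)

    1≤-p : 1# ≤ - p
    1≤-p = ≤0⇒1≤- p≤0

    -- The map `ψ` sends `q` to `a` and `b` to `- p`, matching the `⊑`-interval from `q` to `b` with
    -- that from `a` to `- p`. With respect to the constants of the lower piece, `c` is a complement
    -- of `a`: `a ∨ c ≡ - p` and `a · c ≤ p`.
    a c b : Carrier
    a = q · - p
    c = - (p ∨ a)
    b = q ∨ c

    q≤a : q ≤ a
    q≤a = ≤-·ˡ 1≤-p

    a≤-p : a ≤ - p
    a≤-p = ·≤ʳ (≤0⇒≤1 q≤0)

    a⊑-p : a ⊑ - p
    a⊑-p = x·y⊑y q (- p)

    p∨a⊑-p : p ∨ a ⊑ - p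
    p∨a⊑-p = ⊑-∨ p⊑-p a⊑-p

    c⊑-p : c ⊑ - p
    c⊑-p = -‿⊑-p p∨a⊑-p

    p≤c : p ≤ c
    p≤c = -‿swapʳ (∨-least (≤-trans (≤0⇒≤1 p≤0) 1≤-p) a≤-p)

    0[p∨a]≡p : 0[ p ∨ a ] ≡ p
    0[p∨a]≡p = ≤-antisym (⊑-p⇒0[x]≤p p≤0 p∨a⊑-p) (∧-greatest (x≤x∨y p a) p≤c)

    -- As `p ≤ c`, joining `p` to `a` changes nothing, and the join of `p ∨ a` with its negation is
    -- `- 0[ p ∨ a ]`.
    a∨c≡-p : a ∨ c ≡ - p
    a∨c≡-p = begin
      a ∨ c            ≡⟨ ≤-antisym
                            (∨-least (≤-trans (y≤x∨y p a) (y≤x∨y c (p ∨ a))) (x≤x∨y c (p ∨ a)))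
                            (∨-least (y≤x∨y a c) (∨-least (≤-trans p≤c (y≤x∨y a c)) (x≤x∨y a c))) ⟩
      c ∨ (p ∨ a)      ≡⟨ -x∨x≡-0[x] (p ∨ a) ⟩
      - 0[ p ∨ a ]     ≡⟨ cong -_ 0[p∨a]≡p ⟩
      - p              ∎
      where open ≡-Reasoning

    c≤1 : c ≤ 1#
    c≤1 = subst (c ≤_) -0≡1 (-‿anti
      (subst (_≤ p ∨ a) p∨q≡0 (∨-least (x≤x∨y p a) (≤-trans q≤a (y≤x∨y p a)))))

    b≤1 : b ≤ 1#
    b≤1 = ∨-least (≤0⇒≤1 q≤0) c≤1

    -- From `p ≤ c` follows `p ∨ q ≤ b`, so `b` lies between `0#` and `1#`, and hence so does `- b`.
    0[b]≡0 : 0[ b ] ≡ 0#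
    0[b]≡0 = ≤-antisym (0[x]≤0 b) (∧-greatest
      (subst (_≤ b) p∨q≡0 (∨-least (≤-trans p≤c (y≤x∨y q c)) (x≤x∨y q c)))
      (subst (_≤ - b) -1≡0 (-‿anti b≤1)))

    q⊑b : q ⊑ b
    q⊑b = q≤0[x]⇒q⊑ (subst (q ≤_) (sym 0[b]≡0) q≤0)

    -p·b≡-p : - p · b ≡ - p
    -p·b≡-p = begin
      - p · b            ≡⟨ ·-distribˡ-∨ (- p) q c ⟩
      - p · q ∨ - p · c  ≡⟨ cong₂ _∨_ (·-comm (- p) q) (⊑-p-identity c⊑-p) ⟩
      a ∨ c              ≡⟨ a∨c≡-p ⟩
      - p                ∎
      where open ≡-Reasoning

    φ ψ : Carrier → Carrier
    φ x = q ∨ x · c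
    ψ y = - p · y

    -- The point is `x · c ≤ - q`. Writing `c` as `c · - p` turns the factor `q` into `a`, which
    -- absorbs `x`, and `a · c ≤ 0#` by the choice of `c`.
    φ-upper : ∀ {x} → a ⊑ x → q ⊑ φ x
    φ-upper {x} a⊑x = q≤0[x]⇒q⊑ (∧-greatest (x≤x∨y q (x · c))
      (-‿swapʳ (∨-least (≤-trans (≤0⇒≤1 q≤0) (≤0⇒1≤- q≤0)) (residual (begin
        q · (x · c)            ≡⟨ cong (λ z → q · (x · z)) c⊑-p ⟩
        q · (x · (c · - p))    ≡⟨ solve 4 (λ q x c u → q ⊕ (x ⊕ (c ⊕ u)) ⊜ ((q ⊕ u) ⊕ x) ⊕ c) refl q x c (- p) ⟩
        a · x · c              ≡⟨ cong (_· c) a⊑x ⟨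
        a · c                  ≤⟨ ≤⇒·-≤0 (y≤x∨y p a) ⟩
        0#                     ∎)))))
      where open ≤-Reasoning

    φ-⊑b : ∀ x → φ x ⊑ b
    φ-⊑b x = ≤-antisym
      (∨-least
        (subst (_≤ φ x · b) (·-idem q) (·-mono (x≤x∨y _ _) (x≤x∨y _ _)))
        (subst (_≤ φ x · b) (trans (·-assoc x c c) (cong (x ·_) (·-idem c)))
          (·-mono (y≤x∨y _ _) (y≤x∨y _ _))))
      (·≤ˡ b≤1)

    ψ-lower : ∀ y → ψ y ⊑ - p
    ψ-lower y = subst (_⊑ - p) (·-comm y (- p)) (x·y⊑y y (- p))

    a⊑ψ : ∀ {y} → q ⊑ y → a ⊑ ψ y
    a⊑ψ {y} q⊑y = trans (cong (_· - p) q⊑y)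
      (solve 3 (λ q y u → (q ⊕ y) ⊕ u ⊜ (q ⊕ u) ⊕ (u ⊕ y)) refl q y (- p))

    -- The factor `- p` turns `q` into `a`, which is `x · a`, and fixes `x · c`; distributivity then
    -- reassembles `x · (a ∨ c)`.
    ψ∘φ : ∀ {x} → x ⊑ - p → a ⊑ x → ψ (φ x) ≡ x
    ψ∘φ {x} x⊑-p a⊑x = begin
      - p · (q ∨ x · c)         ≡⟨ ·-distribˡ-∨ (- p) q (x · c) ⟩
      - p · q ∨ - p · (x · c)   ≡⟨ cong₂ _∨_ -p·q≡x·a (⊑-p-identity (subst (_⊑ - p) (·-comm c x) (⊑-·ˡ x⊑-p))) ⟩
      x · a ∨ x · c             ≡⟨ ·-distribˡ-∨ x a c ⟨
      x · (a ∨ c)               ≡⟨ cong (x ·_) a∨c≡-p ⟩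
      x · - p                   ≡⟨ x⊑-p ⟨
      x                         ∎
      where
      open ≡-Reasoning
      -p·q≡x·a : - p · q ≡ x · a
      -p·q≡x·a = trans (·-comm (- p) q) (trans a⊑x (·-comm a x))

    -- The counterpart of `ψ∘φ`, with `q ∨ c`, that is `b`, as the unit reassembled; here `c`
    -- absorbs `- p`.
    φ∘ψ : ∀ {y} → q ⊑ y → y ⊑ b → φ (ψ y) ≡ y
    φ∘ψ {y} q⊑y y⊑b = begin
      q ∨ - p · y · c        ≡⟨ cong₂ _∨_ (trans q⊑y (·-comm q y)) -p·y·c≡y·c ⟩
      y · q ∨ y · c          ≡⟨ ·-distribˡ-∨ y q c ⟨
      y · b                  ≡⟨ y⊑b ⟨
      y                      ∎
      where
      open ≡-Reasoning
      -p·y·c≡y·c : - p · y · c ≡ y · c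
      -p·y·c≡y·c = trans (solve 3 (λ u y c → (u ⊕ y) ⊕ c ⊜ y ⊕ (c ⊕ u)) refl (- p) y c)
        (cong (y ·_) (sym c⊑-p))

    -- Multiplication by the idempotent `- p` preserves products, and joins by distributivity; its
    -- inverse `φ` inherits both.
    φ-· : ∀ {x y} → x ⊑ - p → y ⊑ - p → a ⊑ x → a ⊑ y → φ (x · y) ≡ φ x · φ y
    φ-· {x} {y} x⊑-p y⊑-p a⊑x a⊑y = begin
      φ (x · y)              ≡⟨ cong₂ (λ u v → φ (u · v)) (ψ∘φ x⊑-p a⊑x) (ψ∘φ y⊑-p a⊑y) ⟨
      φ (ψ (φ x) · ψ (φ y))  ≡⟨ cong φ (solve 3 (λ u x y → (u ⊕ x) ⊕ (u ⊕ y) ⊜ u ⊕ (x ⊕ y)) refl (- p) (φ x) (φ y)) ⟩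
      φ (ψ (φ x · φ y))      ≡⟨ φ∘ψ (↑-· (φ-upper a⊑x) (φ-upper a⊑y)) (subst (_⊑ b) (·-comm (φ y) (φ x)) (⊑-·ˡ (φ-⊑b x))) ⟩
      φ x · φ y              ∎
      where open ≡-Reasoning

    φ-∨ : ∀ {x y} → x ⊑ - p → y ⊑ - p → a ⊑ x → a ⊑ y → φ (x ∨ y) ≡ φ x ∨ φ y
    φ-∨ {x} {y} x⊑-p y⊑-p a⊑x a⊑y = begin
      φ (x ∨ y)              ≡⟨ cong₂ (λ u v → φ (u ∨ v)) (ψ∘φ x⊑-p a⊑x) (ψ∘φ y⊑-p a⊑y) ⟨
      φ (ψ (φ x) ∨ ψ (φ y))  ≡⟨ cong φ (·-distribˡ-∨ (- p) (φ x) (φ y)) ⟨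
      φ (ψ (φ x ∨ φ y))      ≡⟨ φ∘ψ (↑-∨ (φ-upper a⊑x) (φ-upper a⊑y)) (⊑-∨ (φ-⊑b x) (φ-⊑b y)) ⟩
      φ x ∨ φ y              ∎
      where open ≡-Reasoning

    -- Here `p` is the zero of the lower piece, and `(p ∨ a) · c` is `0[ p ∨ a ]`.
    φ[a∨p]≡0 : φ (a ∨ p) ≡ 0#
    φ[a∨p]≡0 = begin
      q ∨ (a ∨ p) · c  ≡⟨ cong (λ z → q ∨ z · c) (∨-comm a p) ⟩
      q ∨ (p ∨ a) · c  ≡⟨ cong (q ∨_) (trans (sym (0[x]≡x·-x (p ∨ a))) 0[p∨a]≡p) ⟩
      q ∨ p            ≡⟨ ∨-comm q p ⟩
      p ∨ q            ≡⟨ p∨q≡0 ⟩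
      0#               ∎
      where open ≡-Reasoning

    a≰p : ¬ (a ≤ p)
    a≰p a≤p = q≰p (≤-trans q≤a a≤p)

    ψ[y·b]≡ψ[y] : ∀ y → ψ (y · b) ≡ ψ y
    ψ[y·b]≡ψ[y] y = trans
      (solve 3 (λ u y b → u ⊕ (y ⊕ b) ⊜ (u ⊕ b) ⊕ y) refl (- p) y b)
      (cong (_· y) -p·b≡-p)

    mixed-· : ∀ {x} y → x ⊑ - p → x · ψ (y · b) ≡ x · y
    mixed-· {x} y x⊑-p = begin
      x · ψ (y · b)  ≡⟨ cong (x ·_) (ψ[y·b]≡ψ[y] y) ⟩
      x · (- p · y)  ≡⟨ ·-assoc x (- p) y ⟨
      x · - p · y    ≡⟨ cong (_· y) x⊑-p ⟨
      x · y          ∎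
      where open ≡-Reasoning

    ⊑-p⇒x·a≡x·q : ∀ {x} → x ⊑ - p → x · a ≡ x · q
    ⊑-p⇒x·a≡x·q {x} x⊑-p = trans
      (solve 3 (λ x q u → x ⊕ (q ⊕ u) ⊜ (x ⊕ u) ⊕ q) refl x q (- p))
      (cong (_· q) (sym x⊑-p))

    -- Since `x` may exceed `1#`, monotonicity alone does not suffice. But `x · q ≤ 0#`, so it
    -- equals `0[ x · q ]`, which factors as `0[ x ] · q`.
    ≤-a⇒x·q≤q : ∀ {x} → x ⊑ - p → x ≤ - a → x · q ≤ q
    ≤-a⇒x·q≤q {x} x⊑-p x≤-a = begin
      x · q              ≡⟨ x≤0⇒0[x]≡x x·q≤0 ⟨
      0[ x · q ]         ≡⟨ 0[xy]≡0[x]·0[y] x q ⟩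
      0[ x ] · 0[ q ]    ≡⟨ cong (0[ x ] ·_) (x≤0⇒0[x]≡x q≤0) ⟩
      0[ x ] · q         ≤⟨ ·≤ʳ (≤0⇒≤1 (0[x]≤0 x)) ⟩
      q                  ∎
      where
      open ≤-Reasoning
      x·q≤0 : x · q ≤ 0#
      x·q≤0 = subst (_≤ 0#) (trans (·-comm a x) (⊑-p⇒x·a≡x·q x⊑-p)) (unresidual x≤-a)

    -- Splitting `- p` as `a ∨ c` writes `x` as `x · q ∨ x · c`; the first part lies below `q`, the
    -- second below `(x ∨ a) · c`. The converse uses `c ≤ 1#` and `q ≤ y`.
    mixed-∨-≤ : ∀ {x y} → x ⊑ - p → q ⊑ y → x ≤ - a → φ (x ∨ a) ∨ y ≡ x ∨ y
    mixed-∨-≤ {x} {y} x⊑-p q⊑y x≤-a = ≤-antisym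
      (∨-least (∨-least (≤-trans q≤y (y≤x∨y x y)) [x∨a]·c≤x∨y) (y≤x∨y x y))
      (∨-least x≤ (y≤x∨y _ y))
      where
      open ≤-Reasoning
      q≤y : q ≤ y
      q≤y = q⊑x⇒q≤x q⊑y

      [x∨a]·c≤x∨y : (x ∨ a) · c ≤ x ∨ y
      [x∨a]·c≤x∨y = begin
        (x ∨ a) · c    ≡⟨ ·-distribʳ-∨ c x a ⟩
        x · c ∨ a · c  ≡⟨ cong (λ z → x · c ∨ z) (trans (·-comm a c) (trans (⊑-p⇒x·a≡x·q c⊑-p) (·-comm c q))) ⟩
        x · c ∨ q · c  ≤⟨ ∨-least (≤-trans (·≤ˡ c≤1) (x≤x∨y x y))
                                  (≤-trans (·≤ˡ c≤1) (≤-trans q≤y (y≤x∨y x y))) ⟩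
        x ∨ y          ∎

      x≤ : x ≤ φ (x ∨ a) ∨ y
      x≤ = begin
        x                      ≡⟨ x⊑-p ⟩
        x · - p                ≡⟨ cong (x ·_) a∨c≡-p ⟨
        x · (a ∨ c)            ≡⟨ ·-distribˡ-∨ x a c ⟩
        x · a ∨ x · c          ≡⟨ cong (_∨ x · c) (⊑-p⇒x·a≡x·q x⊑-p) ⟩
        x · q ∨ x · c          ≤⟨ ∨-least (≤-trans (≤-a⇒x·q≤q x⊑-p x≤-a) (x≤x∨y _ _))
                                          (≤-trans (·-mono (x≤x∨y x a) ≤-refl) (y≤x∨y _ _)) ⟩
        φ (x ∨ a)              ≤⟨ x≤x∨y _ y ⟩
        φ (x ∨ a) ∨ y          ∎

    -- If `x ∨ y` is in the lower piece, `- p` fixes it and therefore `ψ y ≤ x ∨ y`. If it is in the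
    -- upper piece, `x ≤ - q`, whence `a · x ≤ 0#`, against the hypothesis.
    mixed-∨-≰ : ∀ {x y} → x ⊑ - p → ¬ (x ≤ - a) → x ∨ ψ (y · b) ≡ x ∨ y
    mixed-∨-≰ {x} {y} x⊑-p x≰-a with split (x ∨ y)
    ... | inj₁ 0[x∨y]≤p = trans (cong (x ∨_) (ψ[y·b]≡ψ[y] y)) (≤-antisym
      (∨-least (x≤x∨y x y)
        (subst (ψ y ≤_) (⊑-p-identity (0[x]≤p⇒⊑-p p≤0 0[x∨y]≤p)) (·-monoʳ (- p) (y≤x∨y x y))))
      (∨-least (x≤x∨y _ _)
        (≤-trans (subst (y ≤_) (·-comm y (- p)) (≤-·ˡ 1≤-p)) (y≤x∨y _ _))))
    ... | inj₂ q≤0[x∨y] = contradiction (residual a·x≤0) x≰-a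
      where
      x≤-q : x ≤ - q
      x≤-q = ≤-trans (x≤x∨y x y) (-‿swapʳ (≤-trans q≤0[x∨y] (x∧y≤y _ _)))

      a·x≤0 : a · x ≤ 0#
      a·x≤0 = subst (_≤ 0#)
        (trans (·-comm q x) (trans (sym (⊑-p⇒x·a≡x·q x⊑-p)) (·-comm x a)))
        (unresidual x≤-q)

    datum : GluingDatum lower-isCIdInRL upper-isCIdInRL
    datum = record
      { a   = a , a⊑-p
      ; a≤1 = lower-≡ a≤-p
      ; a≰0 = λ a≤p → a≰p (cong proj₁ a≤p)
      ; b   = b , q⊑b
      ; b≤1 = upper-≡ b≤1
      ; φ   = mk↔ₛ′
          (λ ((x , _) , a⊑x) → (φ x , φ-upper (cong proj₁ a⊑x)) , upper-≡ (φ-⊑b x))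
          (λ ((y , q⊑y) , _) → (ψ y , ψ-lower y) , lower-≡ (a⊑ψ q⊑y))
          (λ ((_ , q⊑y) , y⊑b) → proj₁-injective ≡-irrelevant (upper-≡ (φ∘ψ q⊑y (cong proj₁ y⊑b))))
          (λ ((_ , x⊑-p) , a⊑x) → proj₁-injective ≡-irrelevant (lower-≡ (ψ∘φ x⊑-p (cong proj₁ a⊑x))))
      ; φ-· = λ {(_ , x⊑-p)} {(_ , y⊑-p)} a⊑x a⊑y →
          upper-≡ (φ-· x⊑-p y⊑-p (cong proj₁ a⊑x) (cong proj₁ a⊑y))
      ; φ-∨ = λ {(_ , x⊑-p)} {(_ , y⊑-p)} a⊑x a⊑y →
          upper-≡ (φ-∨ x⊑-p y⊑-p (cong proj₁ a⊑x) (cong proj₁ a⊑y))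
      ; 0[b]≡φ[a∨0] = upper-≡ (trans 0[b]≡0 (sym φ[a∨p]≡0))
      }

    module A = RawAlgebra lower
    module B = RawAlgebra upper

    _≟ᴬ_ : DecidableEquality A.Carrier
    x ≟ᴬ y = map′ lower-≡ (cong proj₁) (proj₁ x ≟ proj₁ y)

    glued : RawAlgebra ℓ
    glued = gluing lower-isCIdInRL upper-isCIdInRL _≟ᴬ_ datum

    module G = RawAlgebra glued

    open Gluing lower-isCIdInRL upper-isCIdInRL _≟ᴬ_ datum

    from-split : ∀ {x} → 0[ x ] ≤ p ⊎ q ≤ 0[ x ] → G.Carrier
    from-split {x} (inj₁ 0[x]≤p) = inj₁ (x , 0[x]≤p⇒⊑-p p≤0 0[x]≤p)
    from-split {x} (inj₂ q≤0[x]) = inj₂ (x , q≤0[x]⇒q⊑ q≤0[x])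

    to : G.Carrier → Carrier
    to = [ proj₁ , proj₁ ]

    to-from-split : ∀ {x} (s : 0[ x ] ≤ p ⊎ q ≤ 0[ x ]) → to (from-split s) ≡ x
    to-from-split (inj₁ _) = refl
    to-from-split (inj₂ _) = refl

    -- Yields the left inverse law of `bijection` without inspecting which side `split` chose.
    to-injective : ∀ {u v} → to u ≡ to v → u ≡ v
    to-injective {inj₁ _} {inj₁ _} eq = cong inj₁ (lower-≡ eq)
    to-injective {inj₁ (_ , x⊑-p)} {inj₂ (_ , q⊑y)} refl = ⊥-elim (disjoint x⊑-p q⊑y)
    to-injective {inj₂ (_ , q⊑y)} {inj₁ (_ , x⊑-p)} refl = ⊥-elim (disjoint x⊑-p q⊑y)
    to-injective {inj₂ _} {inj₂ _} eq = cong inj₂ (upper-≡ eq)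

    bijection : G.Carrier ↔ Carrier
    bijection = mk↔ₛ′ to (λ x → from-split (split x)) (λ x → to-from-split (split x))
      (λ u → to-injective (to-from-split (split (to u))))

    mixedJoin-homo : ∀ x y → to (inj₁ x G.∨ inj₂ y) ≡ proj₁ x ∨ proj₁ y
    mixedJoin-homo x@(_ , x⊑-p) y@(_ , q⊑y) = by-cases (x ≟ᴬ (x A.∧ A.- (a , a⊑-p)))
      where
      -- The gluing tests `x` against the negation of the lower piece, whose zero is `p`.
      -ᴬa≡-a : a ⇒ p ≡ - a
      -ᴬa≡-a = ⊑-p-negation a⊑-p

      by-cases : Dec (x A.≤ A.- (a , a⊑-p)) → to (inj₁ x G.∨ inj₂ y) ≡ proj₁ x ∨ proj₁ y
      by-cases (yes x≤-a) = trans (cong to (mixedJoin-≤ x y x≤-a))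
        (mixed-∨-≤ x⊑-p q⊑y (subst (proj₁ x ≤_) -ᴬa≡-a (cong proj₁ x≤-a)))
      by-cases (no x≰-a) = trans (cong to (mixedJoin-≰ x y x≰-a))
        (mixed-∨-≰ x⊑-p (λ x≤-a → x≰-a (lower-≡ (subst (proj₁ x ≤_) (sym -ᴬa≡-a) x≤-a))))

    ∨-homo : ∀ u v → to (u G.∨ v) ≡ to u ∨ to v
    ∨-homo (inj₁ x) (inj₁ y) = refl
    ∨-homo (inj₁ x) (inj₂ y) = mixedJoin-homo x y
    ∨-homo (inj₂ y) (inj₁ x) = trans (mixedJoin-homo x y) (∨-comm _ _)
    ∨-homo (inj₂ x) (inj₂ y) = refl

    ·-homo : ∀ u v → to (u G.· v) ≡ to u · to v
    ·-homo (inj₁ x) (inj₁ y) = refl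
    ·-homo (inj₁ (_ , x⊑-p)) (inj₂ (y , _)) = mixed-· y x⊑-p
    ·-homo (inj₂ (y , _)) (inj₁ (_ , x⊑-p)) = trans (mixed-· y x⊑-p) (·-comm _ _)
    ·-homo (inj₂ x) (inj₂ y) = refl

    neg-homo : ∀ u → to (neg u) ≡ - to u
    neg-homo (inj₁ (_ , x⊑-p)) = ⊑-p-negation x⊑-p
    neg-homo (inj₂ _) = refl

    glued≅𝐀 : glued ≅ 𝐀
    glued≅𝐀 = record
      { bijection = bijection
      ; ∧-homo = λ u v → begin
          to (u G.∧ v)               ≡⟨ cong to (∧-as-neg u v) ⟩
          to (neg (neg u G.∨ neg v)) ≡⟨ neg-homo (neg u G.∨ neg v) ⟩
          - to (neg u G.∨ neg v)     ≡⟨ cong -_ (∨-homo (neg u) (neg v)) ⟩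
          - (to (neg u) ∨ to (neg v)) ≡⟨ cong -_ (cong₂ _∨_ (neg-homo u) (neg-homo v)) ⟩
          - (- to u ∨ - to v)        ≡⟨ ∧-def (to u) (to v) ⟨
          to u ∧ to v                ∎
      ; ∨-homo = ∨-homo
      ; ·-homo = ·-homo
      ; ⇒-homo = λ u v → begin
          to (u G.⇒ v)               ≡⟨ cong to (⇒-as-neg u v) ⟩
          to (neg (neg v G.· u))     ≡⟨ neg-homo (neg v G.· u) ⟩
          - to (neg v G.· u)         ≡⟨ cong -_ (·-homo (neg v) u) ⟩
          - (to (neg v) · to u)      ≡⟨ cong (λ z → - (z · to u)) (neg-homo v) ⟩
          - (- to v · to u)          ≡⟨ ⇒-def (to u) (to v) ⟨
          to u ⇒ to v                ∎
      ; 1-homo = refl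
      ; 0-homo = refl
      }
      where open ≡-Reasoning

  -- Choosing the coatom `p` and its least complement `q`.

  module Selection (_≟_ : DecidableEquality Carrier) where

    -- A greedy scan: `0[ x ]` is joined to `p` unless the join reaches `0#`. In that case it still
    -- does for every larger `p′ ≤ 0#`, so later steps preserve the alternative.
    coatom : ∀ xs {p} → p ≤ 0# → p ≢ 0# → ∃ λ p′ → p ≤ p′ × p′ ≤ 0# × p′ ≢ 0# ×
             All (λ x → 0[ x ] ≤ p′ ⊎ p′ ∨ 0[ x ] ≡ 0#) xs
    coatom [] p≤0 p≢0 = _ , ≤-refl , p≤0 , p≢0 , []
    coatom (x ∷ xs) {p} p≤0 p≢0 with (p ∨ 0[ x ]) ≟ 0#
    ... | yes p∨0[x]≡0 =
      let p′ , p≤p′ , p′≤0 , p′≢0 , rest = coatom xs p≤0 p≢0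
          0≤p′∨0[x] = subst (_≤ p′ ∨ 0[ x ]) p∨0[x]≡0
            (∨-least (≤-trans p≤p′ (x≤x∨y _ _)) (y≤x∨y _ _))
      in p′ , p≤p′ , p′≤0 , p′≢0 , inj₂ (≤-antisym (∨-least p′≤0 (0[x]≤0 x)) 0≤p′∨0[x]) ∷ rest
    ... | no p∨0[x]≢0 =
      let p′ , p∨0[x]≤p′ , p′≤0 , p′≢0 , rest = coatom xs (∨-least p≤0 (0[x]≤0 x)) p∨0[x]≢0
      in p′ , ≤-trans (x≤x∨y _ _) p∨0[x]≤p′ , p′≤0 , p′≢0 , inj₁ (≤-trans (y≤x∨y _ _) p∨0[x]≤p′) ∷ rest

    -- Expand `(p ∨ q) · (p ∨ r)`: all factors are at most `1#`, so every term except `q · r` lies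
    -- below `p`.
    ∨≡0-· : ∀ {p q r} → p ≤ 0# → q ≤ 0# → r ≤ 0# → p ∨ q ≡ 0# → p ∨ r ≡ 0# → p ∨ q · r ≡ 0#
    ∨≡0-· {p} {q} {r} p≤0 q≤0 r≤0 p∨q≡0 p∨r≡0 = ≤-antisym
      (∨-least p≤0 (≤-trans (·≤ˡ r≤1) q≤0))
      (begin
        0#                              ≡⟨ ·-idem 0# ⟨
        0# · 0#                         ≡⟨ cong₂ _·_ p∨q≡0 p∨r≡0 ⟨
        (p ∨ q) · (p ∨ r)               ≡⟨ ·-distribˡ-∨ (p ∨ q) p r ⟩
        (p ∨ q) · p ∨ (p ∨ q) · r       ≡⟨ cong ((p ∨ q) · p ∨_) (·-distribʳ-∨ r p q) ⟩
        (p ∨ q) · p ∨ (p · r ∨ q · r)   ≤⟨ ∨-least (≤-trans (·≤ʳ (≤0⇒≤1 (∨-least p≤0 q≤0))) (x≤x∨y _ _))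
                                             (∨-least (≤-trans (·≤ˡ r≤1) (x≤x∨y _ _)) (y≤x∨y _ _)) ⟩
        p ∨ q · r                       ∎)
      where
      open ≤-Reasoning
      r≤1 = ≤0⇒≤1 r≤0

    least-complement : ∀ xs {p} → p ≤ 0# → ∃ λ q → q ≤ 0# × p ∨ q ≡ 0# ×
                       All (λ x → p ∨ 0[ x ] ≡ 0# → q ≤ 0[ x ]) xs
    -- The empty product is `0#` rather than `1#`, so that `q ≤ 0#` holds from the start.
    least-complement [] p≤0 = 0# , ≤-refl , ≤-antisym (∨-least p≤0 ≤-refl) (y≤x∨y _ _) , []
    least-complement (x ∷ xs) {p} p≤0 with least-complement xs p≤0 | (p ∨ 0[ x ]) ≟ 0#
    ... | q , q≤0 , p∨q≡0 , rest | no p∨0[x]≢0 =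
      q , q≤0 , p∨q≡0 , (λ p∨0[x]≡0 → contradiction p∨0[x]≡0 p∨0[x]≢0) ∷ rest
    ... | q , q≤0 , p∨q≡0 , rest | yes p∨0[x]≡0 =
      q · 0[ x ] , ≤-trans q·0[x]≤q q≤0 , ∨≡0-· p≤0 q≤0 (0[x]≤0 x) p∨q≡0 p∨0[x]≡0 ,
      (λ _ → ·≤ʳ (≤0⇒≤1 q≤0)) ∷ All.map (λ q≤ e → ≤-trans q·0[x]≤q (q≤ e)) rest
      where
      q·0[x]≤q : q · 0[ x ] ≤ q
      q·0[x]≤q = ·≤ˡ (≤0⇒≤1 (0[x]≤0 x))

  -- The Boolean case.

  module Boolean (0[x]≡0 : ∀ x → 0[ x ] ≡ 0#) where

    -- From `0[ x ] ≡ 0#` comes `0# ≤ - x`. So the whole algebra is its negative cone, on which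
    -- product and meet coincide.
    x≤1 : ∀ x → x ≤ 1#
    x≤1 x = subst (x ≤_) -0≡1 (-‿swapʳ (subst (_≤ - x) (0[x]≡0 x) (x∧y≤y x (- x))))

    ·≡∧ : ∀ x y → x · y ≡ x ∧ y
    ·≡∧ x y = ≤1⇒·≡∧ (x≤1 x) (x≤1 y)

    ∧-distribʳ-∨ : ∀ x y z → (y ∨ z) ∧ x ≡ (y ∧ x) ∨ (z ∧ x)
    ∧-distribʳ-∨ x y z = begin
      (y ∨ z) ∧ x        ≡⟨ ·≡∧ (y ∨ z) x ⟨
      (y ∨ z) · x        ≡⟨ ·-distribʳ-∨ x y z ⟩
      y · x ∨ z · x      ≡⟨ cong₂ _∨_ (·≡∧ y x) (·≡∧ z x) ⟩
      (y ∧ x) ∨ (z ∧ x)  ∎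
      where open ≡-Reasoning

    -- Residuation supplies distributivity of meet over join, which is join over meet in the dual
    -- lattice; the two laws are swapped back in `isBooleanAlgebra`.
    dualIsDistributiveLattice : IsDistributiveLattice _≡_ _∧_ _∨_
    dualIsDistributiveLattice = isDistributiveLatticeʳʲᵐ record
      { isLattice    = LatticeProperties.∧-∨-isLattice record { isLattice = isLattice }
      ; ∨-distribʳ-∧ = ∧-distribʳ-∨
      }

    isBooleanAlgebra : IsBooleanAlgebra _≡_ _∨_ _∧_ -_ 1# 0#
    isBooleanAlgebra = isBooleanAlgebraʳ record
      { isDistributiveLattice = record
        { isLattice   = isLattice
        ; ∨-distrib-∧ = IsDistributiveLattice.∧-distrib-∨ dualIsDistributiveLattice
        ; ∧-distrib-∨ = IsDistributiveLattice.∨-distrib-∧ dualIsDistributiveLattice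
        }
      ; ∨-complementʳ = λ x → trans (∨-comm x (- x))
          (trans (-x∨x≡-0[x] x) (trans (cong -_ (0[x]≡0 x)) -0≡1))
      ; ∧-complementʳ = 0[x]≡0
      ; ¬-cong        = cong -_
      }

    -x∨y≡x⇒y : ∀ x y → - x ∨ y ≡ x ⇒ y
    -x∨y≡x⇒y x y = begin
      - x ∨ y              ≡⟨ ∨-comm (- x) y ⟩
      y ∨ - x              ≡⟨ cong (_∨ - x) (involutive y) ⟨
      - - y ∨ - x          ≡⟨ involutive _ ⟨
      - - (- - y ∨ - x)    ≡⟨ cong -_ (∧-def (- y) x) ⟨
      - (- y ∧ x)          ≡⟨ cong -_ (·≡∧ (- y) x) ⟨
      - (- y · x)          ≡⟨ ⇒-def x y ⟨
      x ⇒ y                ∎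
      where open ≡-Reasoning

    booleanAlgebra≅𝐀 : booleanAlgebra isBooleanAlgebra ≅ 𝐀
    booleanAlgebra≅𝐀 = record
      { bijection = ↔-id _
      ; ∧-homo = λ _ _ → refl
      ; ∨-homo = λ _ _ → refl
      ; ·-homo = λ x y → sym (·≡∧ x y)
      ; ⇒-homo = -x∨y≡x⇒y
      ; 1-homo = refl
      ; 0-homo = refl
      }

-- Well-founded induction on the number of elements.

constructible : ∀ {n} → Acc _<_ n → (𝐀 : RawAlgebra ℓ) → IsCIdInRL 𝐀 →
                RawAlgebra.Carrier 𝐀 ↔ Fin n → Constructible 𝐀
constructible {n = n} (acc smaller) 𝐀 cA A↔n = by-cases (all? (λ x → 0[ x ] ≟ 0#) elements)
  where
  open Properties cA

  _≟_ : DecidableEquality Carrier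
  _≟_ = inj⇒≟ (↔⇒↣ A↔n)

  open Selection cA _≟_

  elements : List Carrier
  elements = tabulate (Inverse.from A↔n)

  everywhere : {P : Carrier → Set ℓ} → All P elements → ∀ x → P x
  everywhere {P = P} all x = subst P (Inverse.strictlyInverseʳ A↔n x)
    (tabulate⁻ all (Inverse.to A↔n x))

  by-cases : Dec (All (λ x → 0[ x ] ≡ 0#) elements) → Constructible 𝐀
  by-cases (yes all≡0) = iso booleanAlgebra≅𝐀 (boolean (n , A↔n) isBooleanAlgebra)
    where open Boolean cA (everywhere all≡0)
  by-cases (no ¬all≡0) with satisfied (¬All⇒Any¬ (λ x → 0[ x ] ≟ 0#) elements ¬all≡0)
  ... | x₀ , 0[x₀]≢0 with coatom elements (0[x]≤0 x₀) 0[x₀]≢0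
  ... | p , _ , p≤0 , p≢0 , p-coatom with least-complement elements p≤0
  ... | q , q≤0 , p∨q≡0 , q-least =
    iso glued≅𝐀 (glue lower-isCIdInRL upper-isCIdInRL _≟ᴬ_ datum
      (constructible (smaller m₁<n) lower lower-isCIdInRL (proj₂ lower-finite))
      (constructible (smaller m₂<n) upper upper-isCIdInRL (proj₂ upper-finite)))
    where
    -- The second alternative of the coatom, `p ∨ 0[ x ] ≡ 0#`, becomes `q ≤ 0[ x ]` by the
    -- minimality of `q`.
    open Decomposition cA _≟_ p≤0 q≤0 p≢0 p∨q≡0
      (λ x → Sum.map₂ (everywhere q-least x) (everywhere p-coatom x))

    lower-finite : Finite A.Carrier
    lower-finite = finite-Σ (n , A↔n) (λ x → x ≟ (x · - p)) ≡-irrelevant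

    upper-finite : Finite B.Carrier
    upper-finite = finite-Σ (n , A↔n) (λ x → q ≟ (q · x)) ≡-irrelevant

    m₁ m₂ : ℕ
    m₁ = proj₁ lower-finite
    m₂ = proj₁ upper-finite

    m₁+m₂≡n : m₁ + m₂ ≡ n
    m₁+m₂≡n = ⊎-size (proj₂ lower-finite) (proj₂ upper-finite) (A↔n ↔-∘ bijection)

    -- Each piece contains its own unit, so the other one is strictly smaller than the whole.
    m₁<n : m₁ < n
    m₁<n = subst (m₁ <_) m₁+m₂≡n (m<m+n m₁ (inhabited⇒0<size (proj₂ upper-finite) B.1#))

    m₂<n : m₂ < n
    m₂<n = subst (m₂ <_) m₁+m₂≡n (m<n+m m₂ (inhabited⇒0<size (proj₂ lower-finite) A.1#))

theorem6p8 : ∀ {ℓ : Level} (𝐀 : RawAlgebra ℓ) → IsCIdInRL 𝐀 → Finite (RawAlgebra.Carrier 𝐀) → Constructible 𝐀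
theorem6p8 𝐀 cA (n , A↔n) = constructible (<-wellFounded n) 𝐀 cA A↔n
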